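{- Let $\Phi$ be an irreducible finite crystallographic root system and let $\alpha,\alpha'\in\Phi_{\ge-1}$ be such that $(\alpha\|\alpha')=(\alpha'\|\alpha)=1$. If $[\alpha\boxplus\alpha':\alpha_i]>0$ for some $i\in I$, then $[\alpha+\alpha':\alpha_i]>0$.
   Context: $\Phi$ has rank $n$, simple roots $\Pi=\{\alpha_i:i\in I\}$, positive roots $\Phi_{>0}$, root lattice $Q=\mathbb{Z}\Pi$, ambient space $Q_\mathbb{R}$, Cartan matrix $(a_{ij})$ with $s_i(\alpha_j)=\alpha_j-a_{ij}\alpha_i$; $[\alpha:\alpha_i]$ is the coefficient of $\alpha_i$ in $\alpha$. $I=I_+\sqcup I_-$ is the bipartition of the tree Coxeter graph. For $\varepsilon=\pm$, $\tau_\varepsilon:Q_\mathbb{R}\to Q_\mathbb{R}$ is given by $[\tau_\varepsilon\alpha:\alpha_i]=-[\alpha:\alpha_i]-\sum_{j\ne i}a_{ij}\max([\alpha:\alpha_j],0)$ for $i\in I_\varepsilon$, $[\tau_\varepsilon\alpha:\alpha_i]=[\alpha:\alpha_i]$ otherwise. $\Phi_{\ge-1}=\Phi_{>0}\cup(-\Pi)$. The compatibility degree is the unique nonnegative-integer function $(\alpha\|\beta)$ on $\Phi_{\ge-1}^2$ with $(-\alpha_i\|\alpha)=\max([\alpha:\alpha_i],0)$ and $(\tau_\varepsilon\alpha\|\tau_\varepsilon\beta)=(\alpha\|\beta)$. For $n>1$ and $(\alpha\|\alpha')=(\alpha'\|\alpha)=1$, the set $E(\alpha,\alpha')=\{\sigma(\sigma^{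 -1}\alpha+\sigma^{ -1}\alpha'):\sigma\in\langle\tau_+,\tau_-\rangle\}$ consists of exactly two elements of $Q$, namely $\alpha+\alpha'$ and another one denoted $\alpha\boxplus\alpha'$. For $n=1$ (type $A_1$), set $\alpha\boxplus\alpha'=0$. -}

module Defs where

open import Data.Nat using (ℕ; zero; suc) renaming (_<_ to _<ℕ_)
open import Data.Integer using (ℤ; +_; _+_; _*_; -_; _-_; _⊔_; _≤_; _<_; 0ℤ; 1ℤ)
open import Data.Fin using (Fin; zero; suc)
open import Data.Fin.Properties using (_≟_)
open import Data.Bool using (Bool; true; false; if_then_else_)
open import Data.List using (List; []; _∷_; foldr; reverse)
open import Data.Product using (Σ; _×_; _,_; ∃; ∃-syntax)
open import Data.Sum using (_⊎_)
open import Relation.Nullary using (¬_; yes; no)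
open import Relation.Binary.PropositionalEquality using (_≡_; _≢_)

-- Elements of the root lattice Q = ℤΠ, written in the basis of simple roots:
-- x i = [x : α_i].
Vec : ℕ → Set
Vec n = Fin n → ℤ

_≐_ : ∀ {n} → Vec n → Vec n → Set
x ≐ y = ∀ i → x i ≡ y i

_⊕_ : ∀ {n} → Vec n → Vec n → Vec n
(x ⊕ y) i = x i + y i

𝟘 : ∀ {n} → Vec n
𝟘 _ = 0ℤ

simple : ∀ {n} → Fin n → Vec n
simple i j with i ≟ j
... | yes _ = 1ℤ
... | no _ = 0ℤ

neg : ∀ {n} → Vec n → Vec n
neg x i = - x i

∑ : ∀ {n} → (Fin n → ℤ) → ℤ
∑ {zero} f = 0ℤ
∑ {suc n} f = f zero + ∑ {n} (λ i → f (suc i))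

∑≠ : ∀ {n} → Fin n → (Fin n → ℤ) → ℤ
∑≠ i f = ∑ (λ j → if-ne i j (f j))
  where
  if-ne : ∀ {n} → Fin n → Fin n → ℤ → ℤ
  if-ne i j z with i ≟ j
  ... | yes _ = 0ℤ
  ... | no _ = z

Matrix : ℕ → Set
Matrix n = Fin n → Fin n → ℤ

-- Cartan matrices of irreducible finite crystallographic root systems.
-- Convention: s_i(α_j) = α_j - a i j α_i.

record IsIrreducibleFiniteCartan (n : ℕ) (a : Matrix n) : Set where
  field
    rank-pos     : 0 <ℕ n
    diag         : ∀ i → a i i ≡ + 2
    offdiag-nonpos : ∀ i j → i ≢ j → a i j ≤ 0ℤ
    zero-sym     : ∀ i j → a i j ≡ 0ℤ → a j i ≡ 0ℤ
    d            : Fin n → ℤ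
    d-pos        : ∀ i → 0ℤ < d i
    symmetrizable : ∀ i j → d i * a i j ≡ d j * a j i
    pos-def      : ∀ (x : Vec n) → ¬ (x ≐ 𝟘) →
                   0ℤ < ∑ (λ i → ∑ (λ j → x i * (d i * a i j) * x j))
    -- irreducible: the Dynkin diagram is connected
    connected    : ∀ (S : Fin n → Bool) →
                   (∀ i j → S i ≢ S j → a i j ≡ 0ℤ) →
                   ∀ i j → S i ≡ S j

module RootSystem {n : ℕ} (a : Matrix n) where

  s : Fin n → Vec n → Vec n
  s i x j with i ≟ j
  ... | yes _ = x j - ∑ (λ k → a i k * x k)
  ... | no _ = x j

  act : List (Fin n) → Vec n → Vec n
  act w x = foldr s x w

  IsRoot : Vec n → Set
  IsRoot x = ∃[ w ] ∃[ i ] (x ≐ act w (simple i))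

  IsPositiveRoot : Vec n → Set
  IsPositiveRoot x = IsRoot x × (∀ i → 0ℤ ≤ x i)

  AlmostPositive : Vec n → Set
  AlmostPositive x = IsPositiveRoot x ⊎ (∃[ i ] (x ≐ neg (simple i)))

  -- bipartition of I: sign i = true means i ∈ I₊, false means i ∈ I₋
  IsBipartition : (Fin n → Bool) → Set
  IsBipartition sign = ∀ i j → i ≢ j → a i j ≢ 0ℤ → sign i ≢ sign j

  module Tau (sign : Fin n → Bool) where

    -- τ_ε, with ε = true for + and ε = false for -
    τ : Bool → Vec n → Vec n
    τ ε x i with sign i Data.Bool.≟ ε
    ... | yes _ = - x i - ∑≠ i (λ j → a i j * (x j ⊔ 0ℤ))
    ... | no _ = x i

    -- σ ∈ ⟨τ₊,τ₋⟩ given as a word: σ = τ_{ε₁} ∘ ⋯ ∘ τ_{εₖ}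
    applyσ : List Bool → Vec n → Vec n
    applyσ w x = foldr τ x w

    -- σ⁻¹ = τ_{εₖ} ∘ ⋯ ∘ τ_{ε₁}  (each τ_ε is an involution)
    applyσ⁻¹ : List Bool → Vec n → Vec n
    applyσ⁻¹ w x = applyσ (reverse w) x

    IsCompatibilityDegree : (Vec n → Vec n → ℕ) → Set
    IsCompatibilityDegree c =
      (∀ i α → AlmostPositive α → + c (neg (simple i)) α ≡ (α i ⊔ 0ℤ)) ×
      (∀ ε α β → AlmostPositive α → AlmostPositive β →
         c (τ ε α) (τ ε β) ≡ c α β)

    InE : Vec n → Vec n → Vec n → Set
    InE α α' β = ∃[ w ] (β ≐ applyσ w (applyσ⁻¹ w α ⊕ applyσ⁻¹ w α'))

    IsBoxplus : Vec n → Vec n → Vec n → Set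
    IsBoxplus α α' β =
      (n ≡ 1 × β ≐ 𝟘) ⊎
      (1 <ℕ n × InE α α' β × ¬ (β ≐ (α ⊕ α')))

{-# OPTIONS --safe #-}

-- Every σ ∈ ⟨τ₊,τ₋⟩ is subadditive in each coordinate, so β ≤ α + α′ coordinatewise for all β ∈ E(α,α′).
-- The maps τ_ε run the max-plus version of the Y-system y_j(t+1) y_j(t−1) = ∏ (1 + y_k(t))^(−a_jk).  It is solved by
-- polynomials with F_j(t+1) F_j(t−1) = 1 + y_j^(±1) ∏ F_k(t)^(−a_jk) and F(0) = F(1) = 1, which are Laurent polynomials
-- in the initial data (Laurent phenomenon).  Substitute y_j = r^(x_j) s^(x′_j).  All leading coefficients are positive,
-- so the degree in r, the degree in s and the total degree of F are the max-plus solutions started from x, x′ and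
-- x + x′, and the total degree is at most the sum of the other two.

module Submission where

open import Defs
open import Level using (0ℓ)
open import Algebra.Bundles using (CommutativeRing)
open import Data.Nat as ℕ using (ℕ; zero; suc)
import Data.Nat.Properties as ℕ
open import Data.Fin using (Fin; zero; suc)
open import Data.Product using (_×_; _,_; ∃-syntax; proj₁; proj₂)
open import Data.Empty using (⊥-elim)
open import Relation.Nullary using (Dec; yes; no)
open import Relation.Binary.PropositionalEquality as ≡ using (_≡_; _≢_)

-- Products, divisibility and congruence to 1 in a commutative ring.

module Products {c ℓ} (R : CommutativeRing c ℓ) where
  open CommutativeRing R hiding (zero)
  open import Algebra.Properties.CommutativeSemiring.Exp commutativeSemiring public
    using (_^_; ^-distrib-*)
  open import Algebra.Properties.CommutativeSemigroup *-commutativeSemigroup using (interchange)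
  open import Relation.Binary.Reasoning.Setoid setoid

  ∏ : ∀ {n} → (Fin n → Carrier) → Carrier
  ∏ {zero}  f = 1#
  ∏ {suc n} f = f zero * ∏ (λ i → f (suc i))

  power : ∀ {n} → (Fin n → ℕ) → (Fin n → Carrier) → Carrier
  power e x = ∏ (λ k → x k ^ e k)

  ∏-cong : ∀ {n} {f g : Fin n → Carrier} → (∀ i → f i ≈ g i) → ∏ f ≈ ∏ g
  ∏-cong {zero}  f≈g = refl
  ∏-cong {suc n} f≈g = *-cong (f≈g zero) (∏-cong (λ i → f≈g (suc i)))

  ∏-distrib-* : ∀ {n} (f g : Fin n → Carrier) → ∏ (λ i → f i * g i) ≈ ∏ f * ∏ g
  ∏-distrib-* {zero}  f g = sym (*-identityˡ 1#)
  ∏-distrib-* {suc n} f g = begin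
    f zero * g zero * ∏ (λ i → f (suc i) * g (suc i))               ≈⟨ *-congˡ (∏-distrib-* (λ i → f (suc i)) (λ i → g (suc i))) ⟩
    f zero * g zero * (∏ (λ i → f (suc i)) * ∏ (λ i → g (suc i)))   ≈⟨ interchange _ _ _ _ ⟩
    f zero * ∏ (λ i → f (suc i)) * (g zero * ∏ (λ i → g (suc i)))   ∎

  power-distrib-* : ∀ {n} (e : Fin n → ℕ) (x y : Fin n → Carrier) →
                    power e (λ k → x k * y k) ≈ power e x * power e y
  power-distrib-* e x y =
    trans (∏-cong (λ k → ^-distrib-* (x k) (y k) (e k))) (∏-distrib-* (λ k → x k ^ e k) (λ k → y k ^ e k))

  _∣_ : Carrier → Carrier → Set _
  x ∣ y = ∃[ z ] y ≈ x * z

  infix 4 _∣_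

  ∣-power : ∀ {n} (e : Fin n → ℕ) (x : Fin n → Carrier) j → e j ≢ 0 → x j ∣ power e x
  ∣-power {suc n} e x zero e≢0 with e zero
  ... | zero  = ⊥-elim (e≢0 ≡.refl)
  ... | suc m = _ , *-assoc _ _ _
  ∣-power {suc n} e x (suc j) e≢0 with ∣-power (λ k → e (suc k)) (λ k → x (suc k)) j e≢0
  ... | z , eq = x zero ^ e zero * z , (begin
    x zero ^ e zero * power (λ k → e (suc k)) (λ k → x (suc k))   ≈⟨ *-congˡ eq ⟩
    x zero ^ e zero * (x (suc j) * z)                             ≈⟨ *-assoc _ _ _ ⟨
    x zero ^ e zero * x (suc j) * z                               ≈⟨ *-congʳ (*-comm _ _) ⟩
    x (suc j) * x zero ^ e zero * z                               ≈⟨ *-assoc _ _ _ ⟩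
    x (suc j) * (x zero ^ e zero * z)                             ∎)

  -- The cofactor `z` is kept as data because the next exchange value is built from it.
  ≡1mod : Carrier → Carrier → Set _
  ≡1mod x y = ∃[ z ] y ≈ 1# + x * z

  ≡1mod-1 : ∀ x → ≡1mod x 1#
  ≡1mod-1 x = 0# , trans (sym (+-identityʳ 1#)) (+-congˡ (sym (zeroʳ x)))

  ≡1mod-* : ∀ {x y y′} → ≡1mod x y → ≡1mod x y′ → ≡1mod x (y * y′)
  ≡1mod-* {x} {y} {y′} (z , eq) (z′ , eq′) = z′ + z * y′ , (begin
    y * y′                            ≈⟨ *-congʳ eq ⟩
    (1# + x * z) * y′                 ≈⟨ distribʳ _ _ _ ⟩
    1# * y′ + x * z * y′              ≈⟨ +-cong (trans (*-identityˡ y′) eq′) (*-assoc _ _ _) ⟩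
    (1# + x * z′) + x * (z * y′)      ≈⟨ +-assoc _ _ _ ⟩
    1# + (x * z′ + x * (z * y′))      ≈⟨ +-congˡ (distribˡ _ _ _) ⟨
    1# + x * (z′ + z * y′)            ∎)

  ≡1mod-^ : ∀ {x y} m → ≡1mod x y → ≡1mod x (y ^ m)
  ≡1mod-^ {x} zero    p = ≡1mod-1 x
  ≡1mod-^     (suc m) p = ≡1mod-* p (≡1mod-^ m p)

  -- A factor with exponent 0 equals 1 whatever its base, so the congruence is asked on the support
  -- of `e` only.
  ≡1mod-power : ∀ {n} {x} (e : Fin n → ℕ) (y : Fin n → Carrier) →
                (∀ k → e k ≢ 0 → ≡1mod x (y k)) → ≡1mod x (power e y)
  ≡1mod-power {zero}  {x} e y p = ≡1mod-1 x
  ≡1mod-power {suc n} {x} e y p = ≡1mod-* first (≡1mod-power (λ k → e (suc k)) (λ k → y (suc k)) (λ k → p (suc k)))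
    where
    first : ≡1mod x (y zero ^ e zero)
    first with e zero ℕ.≟ 0
    ... | yes e≡0 rewrite e≡0 = ≡1mod-1 x
    ... | no  e≢0 = ≡1mod-^ (e zero) (p zero e≢0)

-- Exchange relations and the Laurent phenomenon.

module Exchange {c ℓ} (R : CommutativeRing c ℓ) {n : ℕ} (e : Fin n → Fin n → ℕ)
                (e-supp : ∀ j k → e j k ≢ 0 → e k j ≢ 0) where
  open CommutativeRing R hiding (zero)
  open Products R
  open import Algebra.Properties.Ring ring using (-‿distribˡ-*)
  open import Algebra.Properties.CommutativeSemigroup *-commutativeSemigroup using (xy∙z≈xz∙y)
  open import Relation.Binary.Reasoning.Setoid setoid

  -- `A`, `B`, `C` are three consecutive time slices, and `π` is the coefficient at the time of `B`.
  Exchanged : (π A B C : Fin n → Carrier) → Set _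
  Exchanged π A B C = ∀ j → C j * A j ≈ 1# + π j * power (e j) B

  -- Laurent phenomenon: the value π⁻¹ A ∏ Dᵉ − G is the exchange partner of C, although no division is performed.
  exchange-next : ∀ {π π⁻¹ ρ A B C D} → (∀ j → π⁻¹ j * π j ≈ 1#) →
                  Exchanged π A B C → Exchanged ρ B C D → ∃[ E ] Exchanged π⁻¹ C D E
  exchange-next {π} {π⁻¹} {ρ} {A} {B} {C} {D} inv exC exD = E , exE
    where
    -- If `e j k ≢ 0` then `e k j ≢ 0`, so `C j` divides `power (e k) C`, and the relation for `D k`
    -- says that `D k * B k` is 1 modulo `C j`.
    DB≡1 : ∀ j → ≡1mod (C j) (power (e j) (λ k → D k * B k))
    DB≡1 j = ≡1mod-power (e j) _ λ k e≢0 →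
      let z , eq = ∣-power (e k) C j (e-supp j k e≢0) in
      ρ k * z , (begin
        D k * B k                    ≈⟨ exD k ⟩
        1# + ρ k * power (e k) C     ≈⟨ +-congˡ (*-congˡ eq) ⟩
        1# + ρ k * (C j * z)         ≈⟨ +-congˡ (trans (sym (*-assoc _ _ _)) (trans (*-congʳ (*-comm _ _)) (*-assoc _ _ _))) ⟩
        1# + C j * (ρ k * z)         ∎)

    G : Fin n → Carrier
    G j = proj₁ (DB≡1 j)

    E : Fin n → Carrier
    E j = π⁻¹ j * power (e j) D * A j - G j

    DB : ∀ j → power (e j) D * power (e j) B ≈ 1# + C j * G j
    DB j = trans (sym (power-distrib-* (e j) D B)) (proj₂ (DB≡1 j))

    exE : Exchanged π⁻¹ C D E
    exE j = begin
      (p * A j - g) * C j                    ≈⟨ distribʳ _ _ _ ⟩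
      p * A j * C j + - g * C j              ≈⟨ +-cong (trans (*-assoc _ _ _) (*-congˡ (trans (*-comm _ _) (exC j)))) (sym (-‿distribˡ-* g (C j))) ⟩
      p * (1# + π j * q) - g * C j           ≈⟨ +-congʳ (trans (distribˡ _ _ _) (+-cong (*-identityʳ p) pπq)) ⟩
      (p + (1# + g * C j)) - g * C j         ≈⟨ +-assoc _ _ _ ⟩
      p + ((1# + g * C j) - g * C j)         ≈⟨ +-congˡ (trans (+-assoc _ _ _) (trans (+-congˡ (-‿inverseʳ _)) (+-identityʳ 1#))) ⟩
      p + 1#                                 ≈⟨ +-comm _ _ ⟩
      1# + p                                 ∎
      where
      g = G j
      q = power (e j) B
      d = power (e j) D
      p = π⁻¹ j * d
      -- `π⁻¹ j` cancels `π j`, and what remains is `DB j`; its multiple of `C j` is what `- G j` in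
      -- `E` removes.
      pπq : p * (π j * q) ≈ 1# + g * C j
      pπq = begin
        π⁻¹ j * d * (π j * q)    ≈⟨ *-assoc _ _ _ ⟨
        π⁻¹ j * d * π j * q      ≈⟨ *-congʳ (xy∙z≈xz∙y _ _ _) ⟩
        π⁻¹ j * π j * d * q      ≈⟨ *-congʳ (trans (*-congʳ (inv j)) (*-identityˡ d)) ⟩
        d * q                    ≈⟨ DB j ⟩
        1# + C j * g             ≈⟨ +-congˡ (*-comm _ _) ⟩
        1# + g * C j             ∎

  module _ (π : ℕ → Fin n → Carrier) (π-inv : ∀ t j → π (2 ℕ.+ t) j * π t j ≈ 1#) where

    private
      -- The slices at times t to t + 3. `exchange-next` consumes two consecutive relations to
      -- produce the next one, so both travel together.
      record Window (t : ℕ) : Set (c Level.⊔ ℓ) where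
        constructor window
        field
          {A B C D} : Fin n → Carrier
          exC : Exchanged (π (suc t)) A B C
          exD : Exchanged (π (suc (suc t))) B C D

      slide : ∀ {t} → Window t → Window (suc t)
      slide {t} (window exC exD) = window exD (proj₂ (exchange-next (π-inv (suc t)) exC exD))

      initial : Window 0
      -- Since `A` and `B` are 1, unification takes `C` and `D` to be the right-hand sides of their
      -- relations.
      initial = window {A = ones} {B = ones} (λ _ → *-identityʳ _) (λ _ → *-identityʳ _)
        where
        ones : Fin n → Carrier
        ones _ = 1#

      windows : ∀ t → Window t
      windows zero    = initial
      windows (suc t) = slide (windows t)

    exchangeSequence : ℕ → Fin n → Carrier
    exchangeSequence t = Window.A (windows t)

    exchangeSequence-exchanged : ∀ t → Exchanged (π (suc t)) (exchangeSequence t)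
                                 (exchangeSequence (suc t)) (exchangeSequence (suc (suc t)))
    -- Sliding a window turns `B` into `A`, so the slices at t + 1 and t + 2 are `B` and `C` by
    -- computation.
    exchangeSequence-exchanged t = Window.exC (windows t)

open import Data.Integer using (ℤ; +_; _+_; _*_; -_; _-_; _⊔_; _≤_; _<_; 0ℤ; 1ℤ; ∣_∣; positive; nonNegative)
import Data.Integer.Properties as ℤ
open import Data.Integer.Tactic.RingSolver using (solve-∀)
open import Data.Bool as Bool using (Bool; true; not)
import Data.Bool.Properties as Bool
open import Data.List using (List; []; _∷_; _++_; map; concatMap; length; reverse)
open import Data.List.Properties using (foldr-++; unfold-reverse)
open import Data.List.Relation.Unary.All as All using (All; []; _∷_)
open import Data.List.Relation.Unary.All.Properties using (++⁺; map⁺)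
open import Data.Fin.Properties using (_≟_)
open import Data.Product.Properties using (≡-dec)
open import Data.Sum using (_⊎_; inj₁; inj₂; [_,_]′)
open import Function using (_∘_)
open import Relation.Binary using (tri<; tri≈; tri>)
open import Relation.Nullary.Decidable using (toSum)
open ≡ using (refl; sym; trans; cong; cong₂; subst; module ≡-Reasoning)

-- Laurent polynomials in r and s with integer coefficients.

-- (a , b) stands for rᵃ sᵇ.
Monomial : Set
Monomial = ℤ × ℤ

infixl 7 _∙_ _⊛_
infixr 7 _·_
infix 4 _≈_

_∙_ : Monomial → Monomial → Monomial
(a , b) ∙ (a′ , b′) = a + a′ , b + b′

𝟙 : Monomial
𝟙 = 0ℤ , 0ℤ

∙-comm : ∀ γ δ → γ ∙ δ ≡ δ ∙ γ
∙-comm (a , b) (a′ , b′) = cong₂ _,_ (ℤ.+-comm a a′) (ℤ.+-comm b b′)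

∙-assoc : ∀ γ δ ε → (γ ∙ δ) ∙ ε ≡ γ ∙ (δ ∙ ε)
∙-assoc (a , b) (a′ , b′) (a″ , b″) = cong₂ _,_ (ℤ.+-assoc a a′ a″) (ℤ.+-assoc b b′ b″)

∙-identityˡ : ∀ γ → 𝟙 ∙ γ ≡ γ
∙-identityˡ (a , b) = cong₂ _,_ (ℤ.+-identityˡ a) (ℤ.+-identityˡ b)

-- Monomials may repeat and coefficients may be 0; `_≈_` disregards this.
Laurent : Set
Laurent = List (ℤ × Monomial)

⟦_⟧ : Laurent → (Monomial → ℤ) → ℤ
⟦ [] ⟧          h = 0ℤ
⟦ (c , γ) ∷ P ⟧ h = c * h γ + ⟦ P ⟧ h

-- Equality of coefficients, tested against all functionals on monomials; this makes
-- the ring laws of the convolution product immediate.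
record _≈_ (P Q : Laurent) : Set where
  constructor mk≈
  field test : ∀ h → ⟦ P ⟧ h ≡ ⟦ Q ⟧ h
open _≈_

_·_ : ℤ × Monomial → Laurent → Laurent
(c , γ) · P = map (λ (d , δ) → c * d , γ ∙ δ) P

_⊛_ : Laurent → Laurent → Laurent
P ⊛ Q = concatMap (_· Q) P

negate : Laurent → Laurent
negate = map (λ (c , γ) → - c , γ)

term : ℤ → Monomial → Laurent
term c γ = (c , γ) ∷ []

⟦⟧-ext : ∀ P {h h′} → (∀ γ → h γ ≡ h′ γ) → ⟦ P ⟧ h ≡ ⟦ P ⟧ h′
⟦⟧-ext []            h≡h′ = refl
⟦⟧-ext ((c , γ) ∷ P) h≡h′ = cong₂ _+_ (cong (c *_) (h≡h′ γ)) (⟦⟧-ext P h≡h′)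

⟦++⟧ : ∀ P Q h → ⟦ P ++ Q ⟧ h ≡ ⟦ P ⟧ h + ⟦ Q ⟧ h
⟦++⟧ []            Q h = sym (ℤ.+-identityˡ _)
⟦++⟧ ((c , γ) ∷ P) Q h = trans (cong₂ _+_ (refl {x = c * h γ}) (⟦++⟧ P Q h)) (sym (ℤ.+-assoc (c * h γ) _ _))

⟦negate⟧ : ∀ P h → ⟦ negate P ⟧ h ≡ - ⟦ P ⟧ h
⟦negate⟧ []            h = refl
⟦negate⟧ ((c , γ) ∷ P) h = trans (cong₂ _+_ (refl {x = - c * h γ}) (⟦negate⟧ P h)) (lemma c (h γ) (⟦ P ⟧ h))
  where
  lemma : ∀ c x y → - c * x + - y ≡ - (c * x + y)
  lemma = solve-∀

⟦·⟧ : ∀ c γ P h → ⟦ (c , γ) · P ⟧ h ≡ c * ⟦ P ⟧ (λ δ → h (γ ∙ δ))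
⟦·⟧ c γ []            h = sym (ℤ.*-zeroʳ c)
⟦·⟧ c γ ((d , δ) ∷ P) h = trans (cong₂ _+_ (refl {x = c * d * h (γ ∙ δ)}) (⟦·⟧ c γ P h)) (lemma c d (h (γ ∙ δ)) _)
  where
  lemma : ∀ c d x y → c * d * x + c * y ≡ c * (d * x + y)
  lemma = solve-∀

-- Testing a product is a double sum: commutativity becomes an exchange of sums, and associativity
-- that of monomials.
⟦⊛⟧ : ∀ P Q h → ⟦ P ⊛ Q ⟧ h ≡ ⟦ P ⟧ (λ γ → ⟦ Q ⟧ (λ δ → h (γ ∙ δ)))
⟦⊛⟧ []            Q h = refl
⟦⊛⟧ ((c , γ) ∷ P) Q h = trans (⟦++⟧ ((c , γ) · Q) (P ⊛ Q) h) (cong₂ _+_ (⟦·⟧ c γ Q h) (⟦⊛⟧ P Q h))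

⟦⟧-0 : ∀ P → ⟦ P ⟧ (λ _ → 0ℤ) ≡ 0ℤ
⟦⟧-0 []            = refl
⟦⟧-0 ((c , γ) ∷ P) = cong₂ _+_ (ℤ.*-zeroʳ c) (⟦⟧-0 P)

⟦⟧-linear : ∀ P c h h′ → ⟦ P ⟧ (λ γ → c * h γ + h′ γ) ≡ c * ⟦ P ⟧ h + ⟦ P ⟧ h′
⟦⟧-linear []            c h h′ = trans (sym (ℤ.*-zeroʳ c)) (sym (ℤ.+-identityʳ _))
⟦⟧-linear ((d , δ) ∷ P) c h h′ =
  trans (cong₂ _+_ (refl {x = d * (c * h δ + h′ δ)}) (⟦⟧-linear P c h h′)) (lemma c d (h δ) (h′ δ) (⟦ P ⟧ h) (⟦ P ⟧ h′))
  where
  lemma : ∀ c d x y z w → d * (c * x + y) + (c * z + w) ≡ c * (d * x + z) + (d * y + w)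
  lemma = solve-∀

⟦⟧-swap : ∀ P Q (f : Monomial → Monomial → ℤ) → ⟦ P ⟧ (λ γ → ⟦ Q ⟧ (f γ)) ≡ ⟦ Q ⟧ (λ δ → ⟦ P ⟧ (λ γ → f γ δ))
⟦⟧-swap []            Q f = sym (⟦⟧-0 Q)
⟦⟧-swap ((c , γ) ∷ P) Q f =
  trans (cong₂ _+_ (refl {x = c * ⟦ Q ⟧ (f γ)}) (⟦⟧-swap P Q f)) (sym (⟦⟧-linear Q c (f γ) (λ δ → ⟦ P ⟧ (λ γ → f γ δ))))

≈-refl : ∀ {P} → P ≈ P
≈-refl = mk≈ λ h → refl

≈-sym : ∀ {P Q} → P ≈ Q → Q ≈ P
≈-sym (mk≈ e) = mk≈ λ h → sym (e h)

≈-trans : ∀ {P Q R} → P ≈ Q → Q ≈ R → P ≈ R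
≈-trans (mk≈ e) (mk≈ e′) = mk≈ λ h → trans (e h) (e′ h)

++-cong : ∀ {P P′ Q Q′} → P ≈ P′ → Q ≈ Q′ → P ++ Q ≈ P′ ++ Q′
++-cong {P} {P′} {Q} {Q′} e e′ = mk≈ λ h →
  trans (⟦++⟧ P Q h) (trans (cong₂ _+_ (test e h) (test e′ h)) (sym (⟦++⟧ P′ Q′ h)))

++-comm : ∀ P Q → P ++ Q ≈ Q ++ P
++-comm P Q = mk≈ λ h → trans (⟦++⟧ P Q h) (trans (ℤ.+-comm (⟦ P ⟧ h) _) (sym (⟦++⟧ Q P h)))

++-assoc : ∀ P Q R → (P ++ Q) ++ R ≈ P ++ (Q ++ R)
++-assoc P Q R = mk≈ λ h → begin
  ⟦ (P ++ Q) ++ R ⟧ h                 ≡⟨ ⟦++⟧ (P ++ Q) R h ⟩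
  ⟦ P ++ Q ⟧ h + ⟦ R ⟧ h              ≡⟨ cong (_+ ⟦ R ⟧ h) (⟦++⟧ P Q h) ⟩
  ⟦ P ⟧ h + ⟦ Q ⟧ h + ⟦ R ⟧ h         ≡⟨ ℤ.+-assoc (⟦ P ⟧ h) _ _ ⟩
  ⟦ P ⟧ h + (⟦ Q ⟧ h + ⟦ R ⟧ h)       ≡⟨ cong₂ _+_ (refl {x = ⟦ P ⟧ h}) (⟦++⟧ Q R h) ⟨
  ⟦ P ⟧ h + ⟦ Q ++ R ⟧ h              ≡⟨ ⟦++⟧ P (Q ++ R) h ⟨
  ⟦ P ++ (Q ++ R) ⟧ h                 ∎
  where open ≡-Reasoning

negate-cong : ∀ {P Q} → P ≈ Q → negate P ≈ negate Q
negate-cong {P} {Q} e = mk≈ λ h → trans (⟦negate⟧ P h) (trans (cong -_ (test e h)) (sym (⟦negate⟧ Q h)))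

negate-inverseˡ : ∀ P → negate P ++ P ≈ []
negate-inverseˡ P = mk≈ λ h →
  trans (⟦++⟧ (negate P) P h) (trans (cong (_+ ⟦ P ⟧ h) (⟦negate⟧ P h)) (ℤ.+-inverseˡ (⟦ P ⟧ h)))

⊛-cong : ∀ {P P′ Q Q′} → P ≈ P′ → Q ≈ Q′ → P ⊛ Q ≈ P′ ⊛ Q′
⊛-cong {P} {P′} {Q} {Q′} e e′ = mk≈ λ h → begin
  ⟦ P ⊛ Q ⟧ h                              ≡⟨ ⟦⊛⟧ P Q h ⟩
  ⟦ P ⟧ (λ γ → ⟦ Q ⟧ (λ δ → h (γ ∙ δ)))    ≡⟨ ⟦⟧-ext P (λ γ → test e′ _) ⟩
  ⟦ P ⟧ (λ γ → ⟦ Q′ ⟧ (λ δ → h (γ ∙ δ)))   ≡⟨ test e _ ⟩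
  ⟦ P′ ⟧ (λ γ → ⟦ Q′ ⟧ (λ δ → h (γ ∙ δ)))  ≡⟨ ⟦⊛⟧ P′ Q′ h ⟨
  ⟦ P′ ⊛ Q′ ⟧ h                            ∎
  where open ≡-Reasoning

⊛-comm : ∀ P Q → P ⊛ Q ≈ Q ⊛ P
⊛-comm P Q = mk≈ λ h → begin
  ⟦ P ⊛ Q ⟧ h                              ≡⟨ ⟦⊛⟧ P Q h ⟩
  ⟦ P ⟧ (λ γ → ⟦ Q ⟧ (λ δ → h (γ ∙ δ)))    ≡⟨ ⟦⟧-swap P Q _ ⟩
  ⟦ Q ⟧ (λ δ → ⟦ P ⟧ (λ γ → h (γ ∙ δ)))    ≡⟨ ⟦⟧-ext Q (λ δ → ⟦⟧-ext P (λ γ → cong h (∙-comm γ δ))) ⟩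
  ⟦ Q ⟧ (λ δ → ⟦ P ⟧ (λ γ → h (δ ∙ γ)))    ≡⟨ ⟦⊛⟧ Q P h ⟨
  ⟦ Q ⊛ P ⟧ h                              ∎
  where open ≡-Reasoning

⊛-assoc : ∀ P Q R → (P ⊛ Q) ⊛ R ≈ P ⊛ (Q ⊛ R)
⊛-assoc P Q R = mk≈ λ h → begin
  ⟦ (P ⊛ Q) ⊛ R ⟧ h                                                  ≡⟨ ⟦⊛⟧ (P ⊛ Q) R h ⟩
  ⟦ P ⊛ Q ⟧ (λ γ → ⟦ R ⟧ (λ ε → h (γ ∙ ε)))                          ≡⟨ ⟦⊛⟧ P Q _ ⟩
  ⟦ P ⟧ (λ γ → ⟦ Q ⟧ (λ δ → ⟦ R ⟧ (λ ε → h ((γ ∙ δ) ∙ ε))))          ≡⟨ ⟦⟧-ext P (λ γ → ⟦⟧-ext Q (λ δ → ⟦⟧-ext R (λ ε → cong h (∙-assoc γ δ ε)))) ⟩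
  ⟦ P ⟧ (λ γ → ⟦ Q ⟧ (λ δ → ⟦ R ⟧ (λ ε → h (γ ∙ (δ ∙ ε)))))          ≡⟨ ⟦⟧-ext P (λ γ → ⟦⊛⟧ Q R _) ⟨
  ⟦ P ⟧ (λ γ → ⟦ Q ⊛ R ⟧ (λ ε → h (γ ∙ ε)))                          ≡⟨ ⟦⊛⟧ P (Q ⊛ R) h ⟨
  ⟦ P ⊛ (Q ⊛ R) ⟧ h                                                  ∎
  where open ≡-Reasoning

⊛-identityˡ : ∀ P → term 1ℤ 𝟙 ⊛ P ≈ P
⊛-identityˡ P = mk≈ λ h → begin
  ⟦ term 1ℤ 𝟙 ⊛ P ⟧ h                     ≡⟨ ⟦⊛⟧ (term 1ℤ 𝟙) P h ⟩
  1ℤ * ⟦ P ⟧ (λ γ → h (𝟙 ∙ γ)) + 0ℤ       ≡⟨ trans (ℤ.+-identityʳ _) (ℤ.*-identityˡ _) ⟩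
  ⟦ P ⟧ (λ γ → h (𝟙 ∙ γ))                 ≡⟨ ⟦⟧-ext P (λ γ → cong h (∙-identityˡ γ)) ⟩
  ⟦ P ⟧ h                                 ∎
  where open ≡-Reasoning

⊛-distribʳ : ∀ R P Q → (P ++ Q) ⊛ R ≈ P ⊛ R ++ Q ⊛ R
⊛-distribʳ R P Q = mk≈ λ h → begin
  ⟦ (P ++ Q) ⊛ R ⟧ h                  ≡⟨ trans (⟦⊛⟧ (P ++ Q) R h) (⟦++⟧ P Q _) ⟩
  ⟦ P ⟧ _ + ⟦ Q ⟧ _                   ≡⟨ cong₂ _+_ (⟦⊛⟧ P R h) (⟦⊛⟧ Q R h) ⟨
  ⟦ P ⊛ R ⟧ h + ⟦ Q ⊛ R ⟧ h           ≡⟨ ⟦++⟧ (P ⊛ R) (Q ⊛ R) h ⟨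
  ⟦ P ⊛ R ++ Q ⊛ R ⟧ h                ∎
  where open ≡-Reasoning

laurentRing : CommutativeRing 0ℓ 0ℓ
laurentRing = record
  { Carrier = Laurent ; _≈_ = _≈_ ; _+_ = _++_ ; _*_ = _⊛_ ; -_ = negate ; 0# = [] ; 1# = term 1ℤ 𝟙
  ; isCommutativeRing = record
    { isRing = record
      { +-isAbelianGroup = record
        { isGroup = record
          { isMonoid = record
            { isSemigroup = record
              { isMagma = record
                { isEquivalence = record { refl = ≈-refl ; sym = ≈-sym ; trans = ≈-trans }
                ; ∙-cong = ++-cong }
              ; assoc = ++-assoc }
            ; identity = (λ P → ≈-refl) , (λ P → ++-comm P []) }
          ; inverse = negate-inverseˡ , (λ P → ≈-trans (++-comm P (negate P)) (negate-inverseˡ P))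
          ; ⁻¹-cong = negate-cong }
        ; comm = ++-comm }
      ; *-cong = ⊛-cong
      ; *-assoc = ⊛-assoc
      ; *-identity = ⊛-identityˡ , (λ P → ≈-trans (⊛-comm P _) (⊛-identityˡ P))
      ; distrib =
          (λ R P Q → ≈-trans (⊛-comm R _) (≈-trans (⊛-distribʳ R P Q) (++-cong (⊛-comm P R) (⊛-comm Q R)))) ,
          ⊛-distribʳ }
    ; *-comm = ⊛-comm } }

term-inverse : ∀ γ δ → γ ∙ δ ≡ 𝟙 → term 1ℤ γ ⊛ term 1ℤ δ ≈ term 1ℤ 𝟙
term-inverse γ δ eq rewrite eq = ≈-refl

-- Coefficients of single monomials.

_≟ᵐ_ : (γ δ : Monomial) → Dec (γ ≡ δ)
_≟ᵐ_ = ≡-dec ℤ._≟_ ℤ._≟_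

χ : Monomial → Monomial → ℤ
χ γ δ with δ ≟ᵐ γ
... | yes _ = 1ℤ
... | no  _ = 0ℤ

χ-refl : ∀ γ → χ γ γ ≡ 1ℤ
χ-refl γ with γ ≟ᵐ γ
... | yes _   = refl
... | no  γ≢γ = ⊥-elim (γ≢γ refl)

χ-≢ : ∀ {γ δ} → δ ≢ γ → χ γ δ ≡ 0ℤ
χ-≢ {γ} {δ} δ≢γ with δ ≟ᵐ γ
... | yes δ≡γ = ⊥-elim (δ≢γ δ≡γ)
... | no  _   = refl

coeff : Laurent → Monomial → ℤ
coeff P γ = ⟦ P ⟧ (χ γ)

coeff-∉ : ∀ {γ P} → All (λ t → proj₂ t ≢ γ) P → coeff P γ ≡ 0ℤ
coeff-∉ []                             = refl
coeff-∉ {P = (c , _) ∷ _} (δ≢γ ∷ rest) =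
  cong₂ _+_ (trans (cong (c *_) (χ-≢ δ≢γ)) (ℤ.*-zeroʳ c)) (coeff-∉ rest)

coeff-head : ∀ {c γ P} → All (λ t → proj₂ t ≢ γ) P → coeff ((c , γ) ∷ P) γ ≡ c
coeff-head {c} {γ} rest = trans (cong₂ _+_ (trans (cong (c *_) (χ-refl γ)) (ℤ.*-identityʳ c)) (coeff-∉ rest)) (ℤ.+-identityʳ c)

m+n-n : ∀ x y → x + y - y ≡ x
m+n-n = solve-∀

-- Gradings, leading terms and degrees.

-- p is the grading of interest; q only breaks ties, so that leading terms are single monomials.
record Grading : Set where
  field
    p q   : Monomial → ℤ
    p-∙   : ∀ γ δ → p (γ ∙ δ) ≡ p γ + p δ
    q-∙   : ∀ γ δ → q (γ ∙ δ) ≡ q γ + q δ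
    p,q-injective : ∀ {γ δ} → p γ ≡ p δ → q γ ≡ q δ → γ ≡ δ

module Degree (G : Grading) where
  open Grading G

  infix 4 _≺_ _⪯_

  _≺_ : Monomial → Monomial → Set
  γ ≺ δ = p γ < p δ ⊎ (p γ ≡ p δ × q γ < q δ)

  _⪯_ : Monomial → Monomial → Set
  γ ⪯ δ = γ ≺ δ ⊎ γ ≡ δ

  ≺-trans : ∀ {γ δ ε} → γ ≺ δ → δ ≺ ε → γ ≺ ε
  ≺-trans (inj₁ a)       (inj₁ b)         = inj₁ (ℤ.<-trans a b)
  ≺-trans (inj₁ a)       (inj₂ (b , _))   = inj₁ (ℤ.<-≤-trans a (ℤ.≤-reflexive b))
  ≺-trans (inj₂ (a , _)) (inj₁ b)         = inj₁ (ℤ.≤-<-trans (ℤ.≤-reflexive a) b)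
  ≺-trans (inj₂ (a , c)) (inj₂ (b , d))   = inj₂ (trans a b , ℤ.<-trans c d)

  ≺⇒≢ : ∀ {γ δ} → γ ≺ δ → γ ≢ δ
  ≺⇒≢ (inj₁ a)       refl = ℤ.<-irrefl refl a
  ≺⇒≢ (inj₂ (_ , a)) refl = ℤ.<-irrefl refl a

  ≺⇒≤ : ∀ {γ δ} → γ ≺ δ → p γ ≤ p δ
  ≺⇒≤ (inj₁ a)       = ℤ.<⇒≤ a
  ≺⇒≤ (inj₂ (a , _)) = ℤ.≤-reflexive a

  data Compare (γ δ : Monomial) : Set where
    lt : γ ≺ δ → Compare γ δ
    eq : γ ≡ δ → Compare γ δ
    gt : δ ≺ γ → Compare γ δ

  compare : ∀ γ δ → Compare γ δ
  compare γ δ with ℤ.<-cmp (p γ) (p δ)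
  ... | tri< a _ _ = lt (inj₁ a)
  ... | tri> _ _ a = gt (inj₁ a)
  ... | tri≈ _ a _ with ℤ.<-cmp (q γ) (q δ)
  ...   | tri< b _ _ = lt (inj₂ (a , b))
  ...   | tri≈ _ b _ = eq (p,q-injective a b)
  ...   | tri> _ _ b = gt (inj₂ (sym a , b))

  ∙-monoʳ-≺ : ∀ γ {δ ε} → δ ≺ ε → γ ∙ δ ≺ γ ∙ ε
  ∙-monoʳ-≺ γ {δ} {ε} (inj₁ a) rewrite p-∙ γ δ | p-∙ γ ε = inj₁ (ℤ.+-monoʳ-< (p γ) a)
  ∙-monoʳ-≺ γ {δ} {ε} (inj₂ (a , b)) rewrite p-∙ γ δ | p-∙ γ ε | q-∙ γ δ | q-∙ γ ε =
    inj₂ (cong₂ _+_ (refl {x = p γ}) a , ℤ.+-monoʳ-< (q γ) b)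

  ∙-mono-≺-⪯ : ∀ {γ δ γ′ δ′} → γ ≺ δ → γ′ ⪯ δ′ → γ ∙ γ′ ≺ δ ∙ δ′
  ∙-mono-≺-⪯ {γ} {δ} {γ′} a (inj₂ refl) rewrite ∙-comm γ γ′ | ∙-comm δ γ′ = ∙-monoʳ-≺ γ′ a
  ∙-mono-≺-⪯ {δ = δ} a (inj₁ b) = ≺-trans (∙-mono-≺-⪯ a (inj₂ refl)) (∙-monoʳ-≺ δ b)

  Below : Monomial → Laurent → Set
  Below γ = All (λ t → proj₂ t ≺ γ)

  Below-trans : ∀ {γ δ P} → γ ≺ δ → Below γ P → Below δ P
  Below-trans a = All.map (λ b → ≺-trans b a)

  -- Here `c` may be 0, which keeps `leading-++≡` unconditional; nonvanishing or positivity is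
  -- imposed separately.
  record Leading (P : Laurent) (c : ℤ) (γ : Monomial) : Set where
    constructor leading
    field
      rest    : Laurent
      below   : Below γ rest
      expand  : P ≈ (c , γ) ∷ rest
  open Leading

  coeff-leading : ∀ {P c γ} → Leading P c γ → coeff P γ ≡ c
  coeff-leading {γ = γ} l = trans (_≈_.test (expand l) (χ γ)) (coeff-head {P = rest l} (All.map ≺⇒≢ (below l)))

  coeff-above : ∀ {P c γ δ} → Leading P c γ → γ ≺ δ → coeff P δ ≡ 0ℤ
  coeff-above {c = c} {γ} {δ} l γ≺δ =
    trans (_≈_.test (expand l) (χ δ)) (coeff-∉ {P = (c , γ) ∷ rest l} (≺⇒≢ γ≺δ ∷ All.map (λ a → ≺⇒≢ (≺-trans a γ≺δ)) (below l)))

  -- Coefficients above the leading monomial vanish, and `p` is the primary key of the order.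
  coeff≢0⇒≤ : ∀ {P c γ δ} → Leading P c γ → coeff P δ ≢ 0ℤ → p δ ≤ p γ
  coeff≢0⇒≤ {γ = γ} {δ} l nz with compare δ γ
  ... | lt a = ≺⇒≤ a
  ... | eq refl = ℤ.≤-refl
  ... | gt a = ⊥-elim (nz (coeff-above l a))

  leading-unique : ∀ {P c d γ δ} → c ≢ 0ℤ → d ≢ 0ℤ → Leading P c γ → Leading P d δ → γ ≡ δ × c ≡ d
  leading-unique {γ = γ} {δ} c≢0 d≢0 l m with compare γ δ
  ... | lt a = ⊥-elim (d≢0 (trans (sym (coeff-leading m)) (coeff-above l a)))
  ... | gt a = ⊥-elim (c≢0 (trans (sym (coeff-leading l)) (coeff-above m a)))
  ... | eq refl = refl , trans (sym (coeff-leading l)) (coeff-leading m)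

  ·-below : ∀ c γ {δ P} → Below δ P → Below (γ ∙ δ) ((c , γ) · P)
  ·-below c γ b = map⁺ (All.map (∙-monoʳ-≺ γ) b)

  ⊛-below : ∀ {γ δ P Q} → Below γ P → All (λ t → proj₂ t ⪯ δ) Q → Below (γ ∙ δ) (P ⊛ Q)
  ⊛-below []      b = []
  ⊛-below (a ∷ as) b = ++⁺ (map⁺ (All.map (∙-mono-≺-⪯ a) b)) (⊛-below as b)

  leading-⊛ : ∀ {P Q c d γ δ} → Leading P c γ → Leading Q d δ → Leading (P ⊛ Q) (c * d) (γ ∙ δ)
  leading-⊛ {c = c} {γ = γ} (leading L bL eP) (leading M bM eQ) =
    leading _ (++⁺ (·-below c γ bM) (⊛-below bL (inj₂ refl ∷ All.map inj₁ bM))) (⊛-cong eP eQ)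

  leading-++ˡ : ∀ {P Q c d γ δ} → Leading P c γ → Leading Q d δ → δ ≺ γ → Leading (P ++ Q) c γ
  leading-++ˡ (leading L bL eP) (leading M bM eQ) a = leading _ (++⁺ bL (a ∷ Below-trans a bM)) (++-cong eP eQ)

  leading-++≡ : ∀ {P Q c d γ} → Leading P c γ → Leading Q d γ → Leading (P ++ Q) (c + d) γ
  leading-++≡ {c = c} {d} {γ} (leading L bL eP) (leading M bM eQ) =
    leading (L ++ M) (++⁺ bL bM) (≈-trans (++-cong eP eQ) (mk≈ λ h →
      trans (cong₂ _+_ (refl {x = c * h γ}) (⟦++⟧ L ((d , γ) ∷ M) h))
      (trans (lemma c d (h γ) (⟦ L ⟧ h) (⟦ M ⟧ h)) (cong₂ _+_ (refl {x = (c + d) * h γ}) (sym (⟦++⟧ L M h))))))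
    where
    lemma : ∀ c d x y z → c * x + (y + (d * x + z)) ≡ (c + d) * x + (y + z)
    lemma = solve-∀

  -- The length bound is a recursion measure: when a new head cancels the leading term, the search
  -- restarts on `rest`, which is shorter but need not be a sublist.
  data Shape (P : Laurent) : Set where
    vanishing    : P ≈ [] → Shape P
    nonvanishing : ∀ {c γ} → c ≢ 0ℤ → (l : Leading P c γ) → length (rest l) ℕ.< length P → Shape P

  Shape-≈ : ∀ {P Q} → P ≈ Q → length Q ℕ.≤ length P → Shape Q → Shape P
  Shape-≈ e _ (vanishing e′) = vanishing (≈-trans e e′)
  Shape-≈ e l (nonvanishing c≢0 (leading L b e′) L<Q) = nonvanishing c≢0 (leading L b (≈-trans e e′)) (ℕ.<-≤-trans L<Q l)

  zero-head : ∀ γ P → (0ℤ , γ) ∷ P ≈ P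
  zero-head γ P = mk≈ λ h → ℤ.+-identityˡ (⟦ P ⟧ h)

  shape-∷ : ∀ c γ P → (∀ Q → length Q ℕ.< length P → Shape Q) → Shape P → Shape ((c , γ) ∷ P)
  shape-∷ c γ P ih (vanishing e) with c ℤ.≟ 0ℤ
  ... | yes refl = vanishing (≈-trans (zero-head γ P) e)
  ... | no  c≢0  = nonvanishing c≢0 (leading [] [] (++-cong (≈-refl {term c γ}) e)) (ℕ.s≤s ℕ.z≤n)
  shape-∷ c γ P ih s@(nonvanishing {d} {δ} d≢0 (leading L b e) L<P) with compare γ δ
  ... | lt a = nonvanishing d≢0
    (leading ((c , γ) ∷ L) (a ∷ b) (≈-trans (++-cong (≈-refl {term c γ}) e) swap-heads))
    (ℕ.s≤s L<P)
    where
    swap-heads : (c , γ) ∷ (d , δ) ∷ L ≈ (d , δ) ∷ (c , γ) ∷ L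
    swap-heads = ++-cong (++-comm (term c γ) (term d δ)) (≈-refl {L})
  ... | gt a with c ℤ.≟ 0ℤ
  ...   | yes refl = Shape-≈ (zero-head γ P) (ℕ.n≤1+n _) s
  ...   | no  c≢0  = nonvanishing c≢0
    (leading ((d , δ) ∷ L) (a ∷ Below-trans a b) (++-cong (≈-refl {term c γ}) e)) (ℕ.s≤s L<P)
  shape-∷ c γ P ih (nonvanishing {d} d≢0 (leading L b e) L<P) | eq refl with (c + d) ℤ.≟ 0ℤ
  ... | yes c+d≡0 = Shape-≈ (≈-trans (++-cong (≈-refl {term c γ}) e) (≈-trans merge vanish))
                      (ℕ.≤-trans (ℕ.<⇒≤ L<P) (ℕ.n≤1+n _)) (ih L L<P)
    where
    merge : (c , γ) ∷ (d , γ) ∷ L ≈ (c + d , γ) ∷ L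
    merge = expand (leading-++≡ (leading [] [] ≈-refl) (leading L b ≈-refl))
    vanish : (c + d , γ) ∷ L ≈ L
    vanish rewrite c+d≡0 = zero-head γ L
  ... | no  c+d≢0 = nonvanishing c+d≢0
    (leading L b (≈-trans (++-cong (≈-refl {term c γ}) e)
      (expand (leading-++≡ (leading [] [] ≈-refl) (leading L b ≈-refl)))))
    (ℕ.<-trans L<P (ℕ.n<1+n _))

  shape-fuel : ∀ m P → length P ℕ.< m → Shape P
  shape-fuel (suc m) []            _           = vanishing ≈-refl
  shape-fuel (suc m) ((c , γ) ∷ P) (ℕ.s≤s P<m) =
    shape-∷ c γ P (λ Q Q<P → shape-fuel m Q (ℕ.<-trans Q<P P<m)) (shape-fuel m P P<m)

  shape : ∀ P → Shape P
  shape P = shape-fuel (suc (length P)) P (ℕ.n<1+n _)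

  -- Positive leading coefficients cannot cancel, which is why the degree of a sum is a maximum in
  -- `degree-++`.
  record HasDegree (P : Laurent) (z : ℤ) : Set where
    constructor hasDegree
    field
      {c}     : ℤ
      {γ}     : Monomial
      c>0     : 0ℤ < c
      lead    : Leading P c γ
      degree  : p γ ≡ z

  private
    >⇒≢ : ∀ {c} → 0ℤ < c → c ≢ 0ℤ
    >⇒≢ 0<c c≡0 = ℤ.<-irrefl (sym c≡0) 0<c

    *-positive : ∀ {c d} → 0ℤ < c → 0ℤ < d → 0ℤ < c * d
    *-positive {c} {d} 0<c 0<d = subst (_< c * d) (ℤ.*-zeroʳ c) (ℤ.*-monoˡ-<-pos c {{positive 0<c}} 0<d)

  HasDegree-≈ : ∀ {P Q z} → P ≈ Q → HasDegree P z → HasDegree Q z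
  HasDegree-≈ e (hasDegree c>0 (leading L b e′) d) = hasDegree c>0 (leading L b (≈-trans (≈-sym e) e′)) d

  degree-term : ∀ γ → HasDegree (term 1ℤ γ) (p γ)
  degree-term γ = hasDegree {c = 1ℤ} {γ} (ℤ.positive⁻¹ 1ℤ) (leading [] [] ≈-refl) refl

  degree-1 : HasDegree (term 1ℤ 𝟙) 0ℤ
  degree-1 = subst (HasDegree (term 1ℤ 𝟙)) p𝟙≡0 (degree-term 𝟙)
    where
    p𝟙≡0 : p 𝟙 ≡ 0ℤ
    p𝟙≡0 = trans (sym (m+n-n (p 𝟙) (p 𝟙))) (trans (cong (_- p 𝟙) (sym (p-∙ 𝟙 𝟙))) (ℤ.+-inverseʳ (p 𝟙)))

  degree-⊛ : ∀ {P Q z w} → HasDegree P z → HasDegree Q w → HasDegree (P ⊛ Q) (z + w)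
  degree-⊛ (hasDegree {γ = γ} c>0 l refl) (hasDegree {γ = δ} d>0 m refl) =
    hasDegree (*-positive c>0 d>0) (leading-⊛ l m) (p-∙ γ δ)

  degree-++ : ∀ {P Q z w} → HasDegree P z → HasDegree Q w → HasDegree (P ++ Q) (z ⊔ w)
  degree-++ {P} {Q} (hasDegree {γ = γ} c>0 l refl) (hasDegree {γ = δ} d>0 m refl) with compare γ δ
  ... | lt a = HasDegree-≈ (++-comm Q P) (hasDegree d>0 (leading-++ˡ m l a) (sym (ℤ.i≤j⇒i⊔j≡j (≺⇒≤ a))))
  ... | gt a = hasDegree c>0 (leading-++ˡ l m a) (sym (ℤ.i≥j⇒i⊔j≡i (≺⇒≤ a)))
  ... | eq refl = hasDegree (ℤ.+-mono-< c>0 d>0) (leading-++≡ l m) (sym (ℤ.⊔-idem (p γ)))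

  -- Exchange values are built with a subtraction, so their positivity is not visible; it is
  -- recovered here. `P` has a leading term because `P ⊛ Q` does not vanish, uniqueness matches the
  -- product of leading terms, and positivity of `a * d` and `d` forces that of `a`.
  degree-/ : ∀ {P Q z w} → HasDegree (P ⊛ Q) z → HasDegree Q w → HasDegree P (z - w)
  degree-/ {P} {Q} (hasDegree {c} {γ} c>0 l refl) (hasDegree {d} {δ} d>0 m refl) with shape P
  ... | vanishing P≈[] = ⊥-elim (>⇒≢ c>0 (trans (sym (coeff-leading l)) (_≈_.test (⊛-cong P≈[] (≈-refl {Q})) (χ γ))))
  ... | nonvanishing {a} {ε} a≢0 k _ with leading-unique (>⇒≢ c>0) ad≢0 l (leading-⊛ k m)
    where
    ad≢0 : a * d ≢ 0ℤ
    ad≢0 e with ℤ.i*j≡0⇒i≡0∨j≡0 a e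
    ... | inj₁ a≡0 = a≢0 a≡0
    ... | inj₂ d≡0 = >⇒≢ d>0 d≡0
  ...   | refl , refl = hasDegree (ℤ.*-cancelʳ-<-nonNeg d {{nonNegative (ℤ.<⇒≤ d>0)}} c>0) k
                          (trans (sym (m+n-n (p ε) (p δ))) (cong (_- p δ) (sym (p-∙ ε δ))))

  open Products laurentRing using (∏; power; _^_)

  degree-^ : ∀ {P z} m → HasDegree P z → HasDegree (P ^ m) (+ m * z)
  degree-^         zero    d = degree-1
  degree-^ {z = z} (suc m) d = subst (HasDegree _) (sym (ℤ.suc-* (+ m) z)) (degree-⊛ d (degree-^ m d))

  degree-∏ : ∀ {n} {f : Fin n → Laurent} {z : Fin n → ℤ} → (∀ k → HasDegree (f k) (z k)) → HasDegree (∏ f) (∑ z)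
  degree-∏ {zero}  d = degree-1
  degree-∏ {suc n} d = degree-⊛ (d zero) (degree-∏ (λ k → d (suc k)))

  degree-power : ∀ {n} (e : Fin n → ℕ) {X : Fin n → Laurent} {z : Fin n → ℤ} →
                 (∀ k → HasDegree (X k) (z k)) → HasDegree (power e X) (∑ (λ k → + e k * z k))
  degree-power e d = degree-∏ (λ k → degree-^ (e k) (d k))

first second total : Grading
first = record
  { p = proj₁ ; q = proj₂ ; p-∙ = λ _ _ → refl ; q-∙ = λ _ _ → refl
  ; p,q-injective = λ a b → cong₂ _,_ a b }
second = record
  { p = proj₂ ; q = proj₁ ; p-∙ = λ _ _ → refl ; q-∙ = λ _ _ → refl
  ; p,q-injective = λ a b → cong₂ _,_ b a }
total = record
  { p = λ (a , b) → a + b ; q = proj₁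
  ; p-∙ = λ (a , b) (a′ , b′) → interchange a b a′ b′ ; q-∙ = λ _ _ → refl
  ; p,q-injective = λ { {a , b} {a′ , b′} s≡ refl → cong (a ,_) (trans (sym (m+n-m a b)) (trans (cong (_- a) s≡) (m+n-m a b′))) } }
  where
  interchange : ∀ a b a′ b′ → a + a′ + (b + b′) ≡ a + b + (a′ + b′)
  interchange = solve-∀
  m+n-m : ∀ x y → x + y - x ≡ y
  m+n-m = solve-∀

-- The leading monomial rᵃ sᵇ for the total degree occurs with nonzero coefficient, so a and b are
-- at most the degrees in r and in s.
total≤first+second : ∀ {P x y z} → Degree.HasDegree first P x → Degree.HasDegree second P y →
                     Degree.HasDegree total P z → z ≤ x + y
total≤first+second {P} (Degree.hasDegree _ l refl) (Degree.hasDegree _ m refl) (Degree.hasDegree {γ = γ} c>0 k refl) =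
  ℤ.+-mono-≤ (Degree.coeff≢0⇒≤ first l nz) (Degree.coeff≢0⇒≤ second m nz)
  where
  nz : coeff P γ ≢ 0ℤ
  nz e = ℤ.<-irrefl (trans (sym e) (Degree.coeff-leading total k)) c>0

-- Finite sums of integers.

∑-cong : ∀ {n} {f g : Fin n → ℤ} → (∀ k → f k ≡ g k) → ∑ f ≡ ∑ g
∑-cong {zero}  f≡g = refl
∑-cong {suc n} f≡g = cong₂ _+_ (f≡g zero) (∑-cong (λ k → f≡g (suc k)))

∑-mono : ∀ {n} {f g : Fin n → ℤ} → (∀ k → f k ≤ g k) → ∑ f ≤ ∑ g
∑-mono {zero}  f≤g = ℤ.≤-refl
∑-mono {suc n} f≤g = ℤ.+-mono-≤ (f≤g zero) (∑-mono (λ k → f≤g (suc k)))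

∑-0 : ∀ n → ∑ {n} (λ _ → 0ℤ) ≡ 0ℤ
∑-0 zero    = refl
∑-0 (suc n) = trans (ℤ.+-identityˡ _) (∑-0 n)

∑-distrib-+ : ∀ {n} (f g : Fin n → ℤ) → ∑ (λ k → f k + g k) ≡ ∑ f + ∑ g
∑-distrib-+ {zero}  f g = refl
∑-distrib-+ {suc n} f g =
  trans (cong₂ _+_ (refl {x = f zero + g zero}) (∑-distrib-+ (λ k → f (suc k)) (λ k → g (suc k))))
        (lemma (f zero) (g zero) _ _)
  where
  lemma : ∀ x y z w → x + y + (z + w) ≡ x + z + (y + w)
  lemma = solve-∀

∑-neg : ∀ {n} (f : Fin n → ℤ) → ∑ (λ k → - f k) ≡ - ∑ f
∑-neg {zero}  f = refl
∑-neg {suc n} f = trans (cong₂ _+_ (refl {x = - f zero}) (∑-neg (λ k → f (suc k)))) (sym (ℤ.neg-distrib-+ (f zero) _))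

∑≠-≡ : ∀ {n} (i : Fin n) (f g : Fin n → ℤ) → (∀ k → i ≡ k → g k ≡ 0ℤ) → (∀ k → i ≢ k → g k ≡ f k) →
       ∑≠ i f ≡ ∑ g
-- The underscore is the summand of ∑≠, a function local to its definition; it is solved by ∑≠-≡.
∑≠-summand : ∀ {n} (i : Fin n) (f g : Fin n → ℤ) → (∀ k → i ≡ k → g k ≡ 0ℤ) → (∀ k → i ≢ k → g k ≡ f k) →
             ∀ k → _ ≡ g k
∑≠-≡ i f g g-diag g-off = ∑-cong (∑≠-summand i f g g-diag g-off)
∑≠-summand i f g g-diag g-off k with i ≟ k
... | yes i≡k = sym (g-diag k i≡k)
... | no  i≢k = sym (g-off k i≢k)

-- The max-plus recursion and its subadditivity.

module Tropical {n : ℕ} (e : Fin n → Fin n → ℕ) where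

  -- Tropical F-polynomials: F(t+2) F(t) = 1 + y(t+1) ∏ F(t+1)ᵉ, where ω(t) is the exponent of y(t).
  tropF : (ℕ → Vec n) → ℕ → Vec n
  -- The exponent of y(t) ∏ F(t)ᵉ; by `tropY-step` these solve the max-plus Y-system.
  tropY : (ℕ → Vec n) → ℕ → Vec n
  tropF ω zero          j = 0ℤ
  tropF ω (suc zero)    j = 0ℤ
  tropF ω (suc (suc t)) j = 0ℤ ⊔ (ω (suc t) j + ∑ (λ k → + e j k * tropF ω (suc t) k)) - tropF ω t j
  tropY ω t j = ω t j + ∑ (λ k → + e j k * tropF ω t k)

  -- The pattern γ, γ, -γ, -γ makes coefficients two steps apart mutually inverse, as the exchange
  -- sequence requires.
  alternating : Vec n → ℕ → Vec n
  alternating γ zero          = γ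
  alternating γ (suc zero)    = γ
  alternating γ (suc (suc t)) = neg (alternating γ t)

  alternating-⊕ : ∀ γ δ t → alternating (γ ⊕ δ) t ≐ (alternating γ t ⊕ alternating δ t)
  alternating-⊕ γ δ zero          j = refl
  alternating-⊕ γ δ (suc zero)    j = refl
  alternating-⊕ γ δ (suc (suc t)) j =
    trans (cong -_ (alternating-⊕ γ δ t j)) (ℤ.neg-distrib-+ (alternating γ t j) (alternating δ t j))

  tropF-0 : ∀ ω t → tropF ω t ≐ 𝟘 → tropY ω t ≐ ω t
  tropF-0 ω t F≡0 j = trans
    (cong₂ _+_ (refl {x = ω t j}) (trans (∑-cong (λ k → trans (cong (+ e j k *_) (F≡0 k)) (ℤ.*-zeroʳ (+ e j k)))) (∑-0 n)))
    (ℤ.+-identityʳ (ω t j))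

  -- After substituting the recursion for F(t+2) and ω(t+2) = -ω(t), the part -∑ e F(t) joins -ω(t)
  -- to form -Y(t). The result has the shape of τ_ε on an updated coordinate.
  tropY-step : ∀ γ t j → tropY (alternating γ) (suc (suc t)) j ≡
               - tropY (alternating γ) t j + ∑ (λ k → + e j k * (tropY (alternating γ) (suc t) k ⊔ 0ℤ))
  tropY-step γ t j = begin
    - w + ∑ (λ k → + e j k * (0ℤ ⊔ Y k - F k))                 ≡⟨ cong₂ _+_ (refl {x = - w}) (∑-cong summand) ⟩
    - w + ∑ (λ k → + e j k * (Y k ⊔ 0ℤ) + - (+ e j k * F k))   ≡⟨ cong₂ _+_ (refl {x = - w}) (∑-distrib-+ u (λ k → - v k)) ⟩
    - w + (∑ u + ∑ (λ k → - v k))                              ≡⟨ cong (λ z → - w + (∑ u + z)) (∑-neg v) ⟩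
    - w + (∑ u + - ∑ v)                                        ≡⟨ lemma w (∑ u) (∑ v) ⟩
    - (w + ∑ v) + ∑ u                                          ∎
    where
    open ≡-Reasoning
    w = alternating γ t j
    Y F u v : Fin n → ℤ
    Y = tropY (alternating γ) (suc t)
    F = tropF (alternating γ) t
    u k = + e j k * (Y k ⊔ 0ℤ)
    v k = + e j k * F k
    distrib : ∀ x y z → x * (y - z) ≡ x * y + - (x * z)
    distrib = solve-∀
    summand : ∀ k → + e j k * (0ℤ ⊔ Y k - F k) ≡ u k + - v k
    summand k = trans (distrib (+ e j k) (0ℤ ⊔ Y k) (F k)) (cong (λ z → + e j k * z + - v k) (ℤ.⊔-comm 0ℤ (Y k)))
    lemma : ∀ x y z → - x + (y + - z) ≡ - (x + z) + y
    lemma = solve-∀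

  module _ (e-supp : ∀ j k → e j k ≢ 0 → e k j ≢ 0) (γ δ : Vec n) where
    open Exchange laurentRing e e-supp
    open Products laurentRing using (power)

    private
      y : ℕ → Fin n → Monomial
      y t j = alternating γ t j , alternating δ t j

      y-inverse : ∀ t j → term 1ℤ (y (2 ℕ.+ t) j) ⊛ term 1ℤ (y t j) ≈ term 1ℤ 𝟙
      y-inverse t j = term-inverse (y (2 ℕ.+ t) j) (y t j) (cong₂ _,_ (ℤ.+-inverseˡ (alternating γ t j)) (ℤ.+-inverseˡ (alternating δ t j)))

      F : ℕ → Fin n → Laurent
      F = exchangeSequence (λ t j → term 1ℤ (y t j)) y-inverse

      F-exchanged : ∀ t j → F (2 ℕ.+ t) j ⊛ F t j ≈ term 1ℤ 𝟙 ++ term 1ℤ (y (1 ℕ.+ t) j) ⊛ power (e j) (F (1 ℕ.+ t))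
      F-exchanged = exchangeSequence-exchanged (λ t j → term 1ℤ (y t j)) y-inverse

    -- Sums, products and exact quotients with positive leading coefficients become max, + and -, so
    -- every grading turns the exchange relation into the recursion of `tropF`.
    degree-F : ∀ G (ω : ℕ → Vec n) → (∀ t j → Grading.p G (y t j) ≡ ω t j) →
               ∀ t j → Degree.HasDegree G (F t j) (tropF ω t j)
    degree-F G ω deg-y = go
      where
      open Degree G
      go : ∀ t j → HasDegree (F t j) (tropF ω t j)
      go zero          j = degree-1
      go (suc zero)    j = degree-1
      go (suc (suc t)) j = degree-/ (HasDegree-≈ (≈-sym (F-exchanged t j))
        (degree-++ degree-1 (degree-⊛ (subst (HasDegree _) (deg-y (suc t) j) (degree-term (y (suc t) j)))
          (degree-power (e j) (go (suc t)))))) (go t j)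

    tropF-subadditive : ∀ t j → tropF (alternating (γ ⊕ δ)) t j ≤ tropF (alternating γ) t j + tropF (alternating δ) t j
    tropF-subadditive t j = total≤first+second
      (degree-F first (alternating γ) (λ _ _ → refl) t j)
      (degree-F second (alternating δ) (λ _ _ → refl) t j)
      (degree-F total (alternating (γ ⊕ δ)) (λ t j → sym (alternating-⊕ γ δ t j)) t j)

    -- The exponents ω are additive in the initial vector and `e` is nonnegative, so the bound on F
    -- passes to Y.
    tropY-subadditive : ∀ t j → tropY (alternating (γ ⊕ δ)) t j ≤ tropY (alternating γ) t j + tropY (alternating δ) t j
    tropY-subadditive t j = ℤ.≤-trans
      (ℤ.+-mono-≤ (ℤ.≤-reflexive (alternating-⊕ γ δ t j))
        (ℤ.≤-trans (∑-mono (λ k → ℤ.*-monoˡ-≤-nonNeg (+ e j k) (tropF-subadditive t k)))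
                   (ℤ.≤-reflexive (trans (∑-cong (λ k → ℤ.*-distribˡ-+ (+ e j k) _ _)) (∑-distrib-+ u v)))))
      (ℤ.≤-reflexive (lemma (alternating γ t j) _ (∑ u) (∑ v)))
      where
      u v : Fin n → ℤ
      u k = + e j k * tropF (alternating γ) t k
      v k = + e j k * tropF (alternating δ) t k
      lemma : ∀ x y z w → x + y + (z + w) ≡ x + z + (y + w)
      lemma = solve-∀

-- The maps τ_ε, words in them and the Y-system.

module Convexity {n : ℕ} (a : Matrix n)
                 (offdiag-nonpos : ∀ i j → i ≢ j → a i j ≤ 0ℤ)
                 (zero-sym : ∀ i j → a i j ≡ 0ℤ → a j i ≡ 0ℤ)
                 (sign : Fin n → Bool) (bipartite : RootSystem.IsBipartition a sign) where
  open RootSystem a hiding (s)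
  open Tau sign

  -- Off-diagonal entries are nonpositive, so this is -a_jk there, as a natural number fit to be an
  -- exponent.
  e : Fin n → Fin n → ℕ
  e j k with j ≟ k
  ... | yes _ = 0
  ... | no  _ = ∣ a j k ∣

  e-diag : ∀ {j k} → j ≡ k → e j k ≡ 0
  e-diag {j} {k} j≡k with j ≟ k
  ... | yes _   = refl
  ... | no  j≢k = ⊥-elim (j≢k j≡k)

  e-off : ∀ {j k} → j ≢ k → + e j k ≡ - a j k
  e-off {j} {k} j≢k with j ≟ k
  ... | yes j≡k = ⊥-elim (j≢k j≡k)
  ... | no  _   = trans (cong +_ (sym (ℤ.∣-i∣≡∣i∣ (a j k)))) (ℤ.0≤i⇒+∣i∣≡i (ℤ.neg-mono-≤ (offdiag-nonpos j k j≢k)))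

  e-supp : ∀ j k → e j k ≢ 0 → e k j ≢ 0
  e-supp j k ejk≢0 ekj≡0 with j ≟ k
  ... | yes _   = ejk≢0 refl
  ... | no  j≢k = ejk≢0 (cong ∣_∣ (zero-sym k j (trans (sym (ℤ.neg-involutive _)) (cong -_ (trans (sym (e-off (j≢k ∘ sym))) (cong +_ ekj≡0))))))

  open Tropical e

  τ-off : ∀ ε x j → sign j ≢ ε → τ ε x j ≡ x j
  τ-off ε x j j∉ε with sign j Bool.≟ ε
  ... | yes j∈ε = ⊥-elim (j∉ε j∈ε)
  ... | no  _   = refl

  -- All neighbours of `j` have the opposite sign, so the sum reads `x` only outside `ε`. Hence `y`
  -- may be a vector whose coordinates in `ε` belong to another time.
  τ-on : ∀ ε x j (y : Vec n) → (∀ k → sign k ≢ ε → x k ≡ y k) → sign j ≡ ε →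
         τ ε x j ≡ - x j + ∑ (λ k → + e j k * (y k ⊔ 0ℤ))
  τ-on ε x j y x≡y refl with sign j Bool.≟ sign j
  ... | no  j∉ε = ⊥-elim (j∉ε refl)
  ... | yes _   = cong₂ _+_ (refl {x = - x j})
    (trans (cong -_ (trans (∑≠-≡ j _ (λ k → - (+ e j k * (y k ⊔ 0ℤ))) diag off) (∑-neg (λ k → + e j k * (y k ⊔ 0ℤ))))) (ℤ.neg-involutive _))
    where
    diag : ∀ k → j ≡ k → - (+ e j k * (y k ⊔ 0ℤ)) ≡ 0ℤ
    diag k j≡k rewrite e-diag j≡k = cong -_ (ℤ.*-zeroˡ (y k ⊔ 0ℤ))
    flip-sign : ∀ x y → - (- x * y) ≡ x * y
    flip-sign = solve-∀
    off : ∀ k → j ≢ k → - (+ e j k * (y k ⊔ 0ℤ)) ≡ a j k * (x k ⊔ 0ℤ)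
    off k j≢k = trans (cong (λ z → - (z * (y k ⊔ 0ℤ))) (e-off j≢k)) (trans (flip-sign (a j k) (y k ⊔ 0ℤ)) same)
      where
      same : a j k * (y k ⊔ 0ℤ) ≡ a j k * (x k ⊔ 0ℤ)
      same with a j k ℤ.≟ 0ℤ
      ... | yes ajk≡0 rewrite ajk≡0 = trans (ℤ.*-zeroˡ (y k ⊔ 0ℤ)) (sym (ℤ.*-zeroˡ (x k ⊔ 0ℤ)))
      ... | no  ajk≢0 = cong (λ z → a j k * (z ⊔ 0ℤ)) (sym (x≡y k (bipartite j k j≢k ajk≢0 ∘ sym)))

  τ-cong : ∀ ε {x y} → x ≐ y → τ ε x ≐ τ ε y
  τ-cong ε {x} {y} x≐y j = [ on , off ]′ (toSum (sign j Bool.≟ ε))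
    where
    off : sign j ≢ ε → τ ε x j ≡ τ ε y j
    off j∉ε = trans (τ-off ε x j j∉ε) (trans (x≐y j) (sym (τ-off ε y j j∉ε)))
    on : sign j ≡ ε → τ ε x j ≡ τ ε y j
    on j∈ε = trans (τ-on ε x j y (λ k _ → x≐y k) j∈ε)
            (trans (cong (λ z → - z + ∑ (λ k → + e j k * (y k ⊔ 0ℤ))) (x≐y j))
                   (sym (τ-on ε y j y (λ _ _ → refl) j∈ε)))

  -- The coordinates that contribute to the sum are fixed by τ_ε, so both applications add the same
  -- `s`.
  τ-involutive : ∀ ε x → τ ε (τ ε x) ≐ x
  τ-involutive ε x j = [ on , off ]′ (toSum (sign j Bool.≟ ε))
    where
    open ≡-Reasoning
    s = ∑ (λ k → + e j k * (x k ⊔ 0ℤ))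
    lemma : ∀ x y → - (- x + y) + y ≡ x
    lemma = solve-∀
    off : sign j ≢ ε → τ ε (τ ε x) j ≡ x j
    off j∉ε = trans (τ-off ε (τ ε x) j j∉ε) (τ-off ε x j j∉ε)
    on : sign j ≡ ε → τ ε (τ ε x) j ≡ x j
    on j∈ε = begin
      τ ε (τ ε x) j            ≡⟨ τ-on ε (τ ε x) j x (τ-off ε x) j∈ε ⟩
      - τ ε x j + s            ≡⟨ cong (λ z → - z + s) (τ-on ε x j x (λ _ _ → refl) j∈ε) ⟩
      - (- x j + s) + s        ≡⟨ lemma (x j) s ⟩
      x j                      ∎

  applyσ-cong : ∀ w {x y} → x ≐ y → applyσ w x ≐ applyσ w y
  applyσ-cong []      x≐y = x≐y
  applyσ-cong (ε ∷ w) x≐y = τ-cong ε (applyσ-cong w x≐y)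

  applyσ-inverse : ∀ w x → applyσ w (applyσ⁻¹ w x) ≐ x
  applyσ-inverse []      x i = refl
  applyσ-inverse (ε ∷ w) x i
    rewrite unfold-reverse ε w | foldr-++ τ x (reverse w) (ε ∷ []) =
    trans (τ-cong ε (applyσ-inverse w (τ ε x)) i) (τ-involutive ε x i)

  -- Letters are counted from the innermost one, `ε`, which acts first.
  letter : Bool → ℕ → Bool
  letter ε zero    = ε
  letter ε (suc m) = not (letter ε m)

  alternate : Bool → ℕ → Vec n → Vec n
  alternate ε zero    x = x
  alternate ε (suc m) x = τ (letter ε m) (alternate ε m x)

  -- Both maps are involutions, so equal adjacent letters cancel and every word reduces to an
  -- alternating one.
  applyσ-alternates : ∀ w → ∃[ ε ] ∃[ m ] (∀ x → applyσ w x ≐ alternate ε m x)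
  applyσ-alternates [] = true , 0 , λ x i → refl
  applyσ-alternates (ε ∷ w) with applyσ-alternates w
  ... | ε′ , m , eq with ε Bool.≟ letter ε′ m
  ...   | yes refl = ε′ , suc m , λ x → τ-cong ε (eq x)
  -- The empty alternating word has no letter to clash with, so its starting letter is reset to `ε`.
  applyσ-alternates (ε ∷ w) | ε′ , zero  , eq | no _ = ε , 1 , λ x → τ-cong ε (eq x)
  -- As `ε` is not the next letter, it equals `letter ε′ m`, the last one applied, and cancels it.
  applyσ-alternates (ε ∷ w) | ε′ , suc m , eq | no ε≢ = ε′ , m , λ x i →
    trans (τ-cong ε (eq x) i)
      (trans (cong (λ b → τ b (alternate ε′ (suc m) x) i) (trans (Bool.¬-not ε≢) (Bool.not-involutive (letter ε′ m))))
             (τ-involutive (letter ε′ m) (alternate ε′ m x) i))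

  -- After m steps the coordinates about to be updated sit at time m, the others already at time m + 1.
  alternate-tropY : ∀ ε m x j →
    (sign j ≡ letter ε m → alternate ε m x j ≡ tropY (alternating x) m j) ×
    (sign j ≢ letter ε m → alternate ε m x j ≡ tropY (alternating x) (suc m) j)
  alternate-tropY ε zero x j =
    -- Times 0 and 1 coincide: F vanishes and the exponent is `x` at both.
    (λ _ → sym (tropF-0 (alternating x) 0 (λ _ → refl) j)) , (λ _ → sym (tropF-0 (alternating x) 1 (λ _ → refl) j))
  alternate-tropY ε (suc m) x j = waiting , updated
    where
    ε′ = letter ε m
    waiting : sign j ≡ not ε′ → τ ε′ (alternate ε m x) j ≡ tropY (alternating x) (suc m) j
    waiting eq = trans (τ-off ε′ (alternate ε m x) j j∉ε′) (proj₂ (alternate-tropY ε m x j) j∉ε′)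
      where
      j∉ε′ : sign j ≢ ε′
      j∉ε′ j∈ε′ = Bool.not-¬ j∈ε′ eq
    updated : sign j ≢ not ε′ → τ ε′ (alternate ε m x) j ≡ tropY (alternating x) (suc (suc m)) j
    -- `τ-on` is fed the slice at time m + 1, correct for all coordinates outside `ε′`, while `j`
    -- itself is still at time m: the pattern of `tropY-step`.
    updated ne = trans (τ-on ε′ (alternate ε m x) j (tropY (alternating x) (suc m)) (λ k → proj₂ (alternate-tropY ε m x k)) j∈ε′)
                (trans (cong (λ z → - z + ∑ (λ k → + e j k * (tropY (alternating x) (suc m) k ⊔ 0ℤ))) (proj₁ (alternate-tropY ε m x j) j∈ε′))
                       (sym (tropY-step x m j)))
      where
      j∈ε′ : sign j ≡ ε′
      j∈ε′ = trans (Bool.¬-not ne) (Bool.not-involutive ε′)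

  -- The time at which coordinate `i` sits depends on its sign, `ε` and `m` but not on the vector,
  -- so all three terms are compared at the same time.
  alternate-subadditive : ∀ ε m x y i → alternate ε m (x ⊕ y) i ≤ alternate ε m x i + alternate ε m y i
  alternate-subadditive ε m x y i with sign i Bool.≟ letter ε m
  ... | yes on rewrite proj₁ (alternate-tropY ε m (x ⊕ y) i) on | proj₁ (alternate-tropY ε m x i) on | proj₁ (alternate-tropY ε m y i) on =
    tropY-subadditive e-supp x y m i
  ... | no off rewrite proj₂ (alternate-tropY ε m (x ⊕ y) i) off | proj₂ (alternate-tropY ε m x i) off | proj₂ (alternate-tropY ε m y i) off =
    tropY-subadditive e-supp x y (suc m) i

  applyσ-subadditive : ∀ w x y i → applyσ w (x ⊕ y) i ≤ applyσ w x i + applyσ w y i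
  applyσ-subadditive w x y i with applyσ-alternates w
  ... | ε , m , eq rewrite eq (x ⊕ y) i | eq x i | eq y i = alternate-subadditive ε m x y i

  -- Subadditivity of σ is applied to σ⁻¹α and σ⁻¹α′, and σ then undoes σ⁻¹ in each summand.
  InE⇒≤ : ∀ {α α′ β} → InE α α′ β → ∀ i → β i ≤ (α ⊕ α′) i
  InE⇒≤ {α} {α′} (w , β≐) i = ℤ.≤-trans (ℤ.≤-reflexive (β≐ i))
    (ℤ.≤-trans (applyσ-subadditive w _ _ i)
      (ℤ.≤-reflexive (cong₂ _+_ (applyσ-inverse w α i) (applyσ-inverse w α′ i))))

theorem1p17 : ∀ (n : ℕ) (a : Matrix n) → IsIrreducibleFiniteCartan n a →
    ∀ (sign : Fin n → Bool) → RootSystem.IsBipartition a sign →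
    ∀ (c : Vec n → Vec n → ℕ) → RootSystem.Tau.IsCompatibilityDegree a sign c →
    ∀ (α α' : Vec n) → RootSystem.AlmostPositive a α → RootSystem.AlmostPositive a α' →
    c α α' ≡ 1 → c α' α ≡ 1 →
    ∀ (β : Vec n) → RootSystem.Tau.IsBoxplus a sign α α' β →
    ∀ (i : Fin n) → 0ℤ < β i → 0ℤ < (α ⊕ α') i
theorem1p17 n a cartan sign bip c c-deg α α' _ _ _ _ β (inj₁ (_ , β≐𝟘)) i 0<β =
  ⊥-elim (ℤ.<-irrefl (sym (β≐𝟘 i)) 0<β)
theorem1p17 n a cartan sign bip c c-deg α α' _ _ _ _ β (inj₂ (_ , β∈E , _)) i 0<β =
  ℤ.<-≤-trans 0<β (InE⇒≤ β∈E i)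
  where
  open IsIrreducibleFiniteCartan cartan using (offdiag-nonpos; zero-sym)
  open Convexity a offdiag-nonpos zero-sym sign bip using (InE⇒≤)
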